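{- Bicrucial permutations with respect to squares of even length exist, and the shortest such permutation of even length has length $32$.
   Context: Permutations are written in one-line notation. A factor is a sequence of consecutive entries; two sequences of distinct numbers of equal length are order-isomorphic if their entries are in the same relative order. A square is a factor $XY$ with $X,Y$ consecutive, of equal length at least $2$, and order-isomorphic. A permutation is square-free if it contains no square. For $\pi=\pi_1\cdots\pi_n$, $x\in\{1,\dots,n+1\}$ and $i\in\{0,\dots,n\}$, the extension of $\pi$ by $x$ in position $i$ is $\pi'_1\cdots\pi'_i\,x\,\pi'_{i+1}\cdots\pi'_n$, where $\pi'_j=\pi_j$ if $\pi_j<x$ and $\pi'_j=\pi_j+1$ otherwise; $i=0$ gives an extension to the left and $i=n$ an extension to the right. A permutation is bicrucial with respect to squares if it is square-free but every extension of it to the left and every extension of it to the right (by any element) contains a square. -}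

module Defs where

open import Data.Nat using (ℕ; zero; suc; _≤_; _<_; _<ᵇ_)
open import Data.Bool using (if_then_else_)
open import Data.List using (List; []; _∷_; _++_; length; map; take; drop; lookup)
open import Data.List.Relation.Unary.All using (All)
open import Data.List.Relation.Unary.Unique.Propositional using (Unique)
open import Data.Fin using (Fin; cast)
open import Data.Product using (Σ; ∃; _×_)
open import Function.Bundles using (_⇔_)
open import Relation.Binary.PropositionalEquality using (_≡_)
open import Relation.Nullary using (¬_)

IsPerm : ℕ → List ℕ → Set
IsPerm n π = (length π ≡ n) × All (λ x → 1 ≤ x × x ≤ n) π × Unique π

OrderIso : List ℕ → List ℕ → Set
OrderIso X Y =
  Σ (length X ≡ length Y) λ eq →
    ∀ (i j : Fin (length X)) →
      (lookup X i < lookup X j) ⇔ (lookup Y (cast eq i) < lookup Y (cast eq j))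

ContainsSquare : List ℕ → Set
ContainsSquare π =
  ∃ λ (pre : List ℕ) → ∃ λ (X : List ℕ) → ∃ λ (Y : List ℕ) → ∃ λ (suf : List ℕ) →
    (π ≡ pre ++ X ++ Y ++ suf) × (length X ≡ length Y) × (2 ≤ length X) × OrderIso X Y

SquareFree : List ℕ → Set
SquareFree π = ¬ ContainsSquare π

extend : List ℕ → ℕ → ℕ → List ℕ
extend π x i = take i π' ++ x ∷ drop i π'
  where
  π' = map (λ p → if p <ᵇ x then p else suc p) π

-- Bicrucial with respect to squares (π assumed a permutation of length n).
Bicrucial : ℕ → List ℕ → Set
Bicrucial n π =
  SquareFree π ×
  (∀ x → 1 ≤ x → x ≤ suc n → ContainsSquare (extend π x 0)) ×
  (∀ x → 1 ≤ x → x ≤ suc n → ContainsSquare (extend π x n))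

{-# OPTIONS --safe #-}

-- Square-freeness forces ascents and descents to satisfy "i is an ascent iff i + 2 is a descent",
-- so apart from half-length 2 only half-lengths divisible by 4 are possible for a square, and
-- a permutation of even length n ≥ 4 has a monotone triple at exactly one of its two ends. By
-- symmetry let it be π₁ < π₂ < π₃. The elements just above π₁, π₂ and π₃ each create a square
-- when put in front, and n ≤ 30 leaves the half-lengths 4, 8 and 12. The second half of a square
-- fixes the place of the new element among π₁, π₂, π₃, so the three half-lengths are distinct and
-- all of them occur. But then π₁…π₄ is order-isomorphic both to π₉…π₁₂ (half-length 8) and to
-- π₁₃…π₁₆ (half-length 12), which is a square in π.
module Submission where

open import Defs
open import Data.Bool using (true; false; if_then_else_; T)
open import Data.Empty using (⊥-elim)
open import Data.Fin using (Fin; zero; suc; toℕ; fromℕ<; cast)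
open import Data.Fin.Properties using (toℕ<n; toℕ-fromℕ<; toℕ-cast)
open import Data.List
  using (List; []; _∷_; _++_; _∷ʳ_; length; map; take; drop; lookup; reverse)
open import Data.List.Properties
open import Data.List.Relation.Binary.Permutation.Propositional using (↭-sym; ↭⇒↭ₛ)
open import Data.List.Relation.Binary.Permutation.Propositional.Properties
  using (All-resp-↭; ↭-reverse)
import Data.List.Relation.Binary.Permutation.Setoid.Properties as SetoidPermutation
open import Data.List.Relation.Unary.All using (All; []; _∷_; all?)
open import Data.List.Relation.Unary.AllPairs using ([]; _∷_)
open import Data.List.Relation.Unary.Unique.Propositional using (Unique)
open import Data.Nat
  using (ℕ; zero; suc; _+_; _*_; _∸_; _≤_; _<_; _<ᵇ_; z≤n; s≤s; s≤s⁻¹; _≟_; _≤?_; _<?_)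
open import Data.List.Relation.Unary.Unique.DecPropositional _≟_ using (unique?)
open import Data.Nat.Divisibility
  using (_∣_; divides; ∣m+n∣m⇒∣n; ∣m∣n⇒∣m+n; ∣-refl; _∣?_)
open import Data.Nat.Properties
open import Data.Product using (∃; _×_; _,_; proj₂)
open import Data.Sum using (_⊎_; inj₁; inj₂; [_,_]′)
open import Function using (_∘_; flip)
open import Function.Bundles using (_⇔_; mk⇔; Equivalence)
open import Relation.Binary.Definitions using (tri<; tri≈; tri>)
open import Relation.Binary.PropositionalEquality
open import Relation.Nullary using (¬_; Dec)
open import Relation.Nullary.Decidable using (map′; _×-dec_; _→-dec_; toWitness; toWitnessFalse)

open Equivalence using (to; from)

-- Entries of a list by natural-number position.

-- The default `0` past the end lets `nth-++ʳ` and `nth-drop` hold at every index.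
nth : List ℕ → ℕ → ℕ
nth []       _       = 0
nth (x ∷ xs) zero    = x
nth (x ∷ xs) (suc i) = nth xs i

nth-++ˡ : ∀ xs ys {i} → i < length xs → nth (xs ++ ys) i ≡ nth xs i
nth-++ˡ (x ∷ xs) ys {zero}  _   = refl
nth-++ˡ (x ∷ xs) ys {suc i} i<n = nth-++ˡ xs ys (s≤s⁻¹ i<n)

nth-++ʳ : ∀ xs ys i → nth (xs ++ ys) (length xs + i) ≡ nth ys i
nth-++ʳ []       ys i = refl
nth-++ʳ (x ∷ xs) ys i = nth-++ʳ xs ys i

nth-take : ∀ n xs {i} → i < n → nth (take n xs) i ≡ nth xs i
nth-take (suc n) []       i<n           = refl
nth-take (suc n) (x ∷ xs) {zero}  _     = refl
nth-take (suc n) (x ∷ xs) {suc i} i<n   = nth-take n xs (s≤s⁻¹ i<n)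

nth-drop : ∀ n xs i → nth (drop n xs) i ≡ nth xs (n + i)
nth-drop zero    xs       i = refl
nth-drop (suc n) []       i = refl
nth-drop (suc n) (x ∷ xs) i = nth-drop n xs i

nth-map : ∀ (f : ℕ → ℕ) xs {i} → i < length xs → nth (map f xs) i ≡ f (nth xs i)
nth-map f (x ∷ xs) {zero}  _   = refl
nth-map f (x ∷ xs) {suc i} i<n = nth-map f xs (s≤s⁻¹ i<n)

nth-lookup : ∀ xs (i : Fin (length xs)) → nth xs (toℕ i) ≡ lookup xs i
nth-lookup (x ∷ xs) zero    = refl
nth-lookup (x ∷ xs) (suc i) = nth-lookup xs i

nth-∷ʳ : ∀ xs x → nth (xs ∷ʳ x) (length xs) ≡ x
nth-∷ʳ []       x = refl
nth-∷ʳ (_ ∷ xs) x = nth-∷ʳ xs x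

nth-reverse : ∀ xs {i} → i < length xs → nth (reverse xs) i ≡ nth xs (length xs ∸ suc i)
nth-reverse (x ∷ xs) {i} i<n rewrite unfold-reverse x xs with m≤n⇒m<n∨m≡n (s≤s⁻¹ i<n)
... | inj₂ refl rewrite n∸n≡0 (length xs) =
  trans (cong (nth (reverse xs ∷ʳ x)) (sym (length-reverse xs))) (nth-∷ʳ (reverse xs) x)
... | inj₁ i<m = begin
  nth (reverse xs ∷ʳ x) i          ≡⟨ nth-++ˡ (reverse xs) _ (subst (i <_) (sym (length-reverse xs)) i<m) ⟩
  nth (reverse xs) i               ≡⟨ nth-reverse xs i<m ⟩
  nth xs (length xs ∸ suc i)       ≡⟨⟩
  nth (x ∷ xs) (suc (length xs ∸ suc i)) ≡⟨ cong (nth (x ∷ xs)) (+-∸-assoc 1 i<m) ⟨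
  nth (x ∷ xs) (length xs ∸ i)     ∎
  where open ≡-Reasoning

All-nth : ∀ {P : ℕ → Set} {xs} → All P xs → ∀ {i} → i < length xs → P (nth xs i)
All-nth (p ∷ ps) {zero}  _   = p
All-nth (p ∷ ps) {suc i} i<n = All-nth ps (s≤s⁻¹ i<n)

nth-injective : ∀ {xs} → Unique xs → ∀ {i j} → i < length xs → j < length xs →
                nth xs i ≡ nth xs j → i ≡ j
nth-injective (x∉ ∷ u) {zero}  {zero}  _   _   _  = refl
nth-injective (x∉ ∷ u) {zero}  {suc j} _   j<n eq = ⊥-elim (All-nth x∉ (s≤s⁻¹ j<n) eq)
nth-injective (x∉ ∷ u) {suc i} {zero}  i<n _   eq = ⊥-elim (All-nth x∉ (s≤s⁻¹ i<n) (sym eq))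
nth-injective (x∉ ∷ u) {suc i} {suc j} i<n j<n eq =
  cong suc (nth-injective u (s≤s⁻¹ i<n) (s≤s⁻¹ j<n) eq)

Unique-reverse : ∀ {xs : List ℕ} → Unique xs → Unique (reverse xs)
Unique-reverse {xs} =
  SetoidPermutation.Unique-resp-↭ (setoid ℕ) (↭⇒↭ₛ (↭-sym (↭-reverse xs)))

-- Order isomorphism by positions, and reversal.

SameOrder : ℕ → (ℕ → ℕ) → (ℕ → ℕ) → Set
SameOrder l p q = ∀ {j} → j < l → ∀ {k} → k < l → (p j < p k) ⇔ (q j < q k)

sameOrder-cong : ∀ {l p p′ q q′} → (∀ {j} → j < l → p j ≡ p′ j) → (∀ {j} → j < l → q j ≡ q′ j) →
                 SameOrder l p q → SameOrder l p′ q′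
sameOrder-cong p≡ q≡ s j<l k<l =
  subst₂ _⇔_ (cong₂ _<_ (p≡ j<l) (p≡ k<l)) (cong₂ _<_ (q≡ j<l) (q≡ k<l)) (s j<l k<l)

orderIso⇒sameOrder : ∀ X Y → OrderIso X Y → SameOrder (length X) (nth X) (nth Y)
orderIso⇒sameOrder X Y (eq , iso) j<l k<l =
  subst₂ _⇔_ (cong₂ _<_ (inX j<l) (inX k<l)) (cong₂ _<_ (inY j<l) (inY k<l))
    (iso (fromℕ< j<l) (fromℕ< k<l))
  where
  inX : ∀ {j} (j<l : j < length X) → lookup X (fromℕ< j<l) ≡ nth X j
  inX j<l = trans (sym (nth-lookup X _)) (cong (nth X) (toℕ-fromℕ< j<l))
  inY : ∀ {j} (j<l : j < length X) → lookup Y (cast eq (fromℕ< j<l)) ≡ nth Y j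
  inY j<l = trans (sym (nth-lookup Y _))
    (cong (nth Y) (trans (toℕ-cast eq (fromℕ< j<l)) (toℕ-fromℕ< j<l)))

sameOrder⇒orderIso : ∀ X Y → length X ≡ length Y → SameOrder (length X) (nth X) (nth Y) →
                     OrderIso X Y
sameOrder⇒orderIso X Y eq s = eq , λ i j →
  subst₂ _⇔_ (cong₂ _<_ (nth-lookup X i) (nth-lookup X j)) (cong₂ _<_ (inY i) (inY j))
    (s (toℕ<n i) (toℕ<n j))
  where
  inY : ∀ i → nth Y (toℕ i) ≡ lookup Y (cast eq i)
  inY i = trans (cong (nth Y) (sym (toℕ-cast eq i))) (nth-lookup Y (cast eq i))

-- Reversing a list also exchanges the two halves of a square, so the equivalence at the mirrored
-- positions is read backwards.
orderIso-reverse : ∀ X Y → OrderIso X Y → OrderIso (reverse Y) (reverse X)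
orderIso-reverse X Y iso@(eq , _) =
  sameOrder⇒orderIso (reverse Y) (reverse X) (trans (length-reverse Y) (trans (sym eq) (sym (length-reverse X))))
    (subst (λ l → SameOrder l (nth (reverse Y)) (nth (reverse X))) (sym (length-reverse Y)) s)
  where
  s : SameOrder (length Y) (nth (reverse Y)) (nth (reverse X))
  s {j} j<l {k} k<l =
    subst₂ _⇔_ (cong₂ _<_ (sym (nth-reverse Y j<l)) (sym (nth-reverse Y k<l)))
               (cong₂ _<_ (inX j<l) (inX k<l))
      (mk⇔ (from e) (to e))
    where
    inX : ∀ {j} → j < length Y → nth X (length Y ∸ suc j) ≡ nth (reverse X) j
    inX {j} j<l = trans (cong (λ l → nth X (l ∸ suc j)) (sym eq))
      (sym (nth-reverse X (subst (j <_) (sym eq) j<l)))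
    mirror : ∀ {j} → j < length Y → length Y ∸ suc j < length X
    mirror {j} j<l = subst (length Y ∸ suc j <_) (sym eq)
      (∸-monoʳ-< {length Y} {suc j} {0} (s≤s z≤n) j<l)
    e = orderIso⇒sameOrder X Y iso (mirror j<l) (mirror k<l)

containsSquare-reverse : ∀ {xs} → ContainsSquare xs → ContainsSquare (reverse xs)
containsSquare-reverse (pre , X , Y , suf , refl , eq , 2≤ , iso) =
  reverse suf , reverse Y , reverse X , reverse pre , split ,
  trans (length-reverse Y) (trans (sym eq) (sym (length-reverse X))) ,
  subst (2 ≤_) (trans eq (sym (length-reverse Y))) 2≤ ,
  orderIso-reverse X Y iso
  where
  open ≡-Reasoning
  split : reverse (pre ++ X ++ Y ++ suf) ≡ reverse suf ++ reverse Y ++ reverse X ++ reverse pre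
  split = begin
    reverse (pre ++ X ++ Y ++ suf)                             ≡⟨ reverse-++ pre _ ⟩
    reverse (X ++ Y ++ suf) ++ reverse pre                     ≡⟨ cong (_++ reverse pre) (reverse-++ X _) ⟩
    (reverse (Y ++ suf) ++ reverse X) ++ reverse pre           ≡⟨ ++-assoc (reverse (Y ++ suf)) _ _ ⟩
    reverse (Y ++ suf) ++ reverse X ++ reverse pre             ≡⟨ cong (_++ _) (reverse-++ Y suf) ⟩
    (reverse suf ++ reverse Y) ++ reverse X ++ reverse pre     ≡⟨ ++-assoc (reverse suf) _ _ ⟩
    reverse suf ++ reverse Y ++ reverse X ++ reverse pre       ∎

containsSquare-∷ : ∀ {x xs} → ContainsSquare xs → ContainsSquare (x ∷ xs)
containsSquare-∷ {x} (pre , X , Y , suf , eq , rest) = x ∷ pre , X , Y , suf , cong (x ∷_) eq , rest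

-- Squares by starting position and half-length.

SquareAt : (ℕ → ℕ) → ℕ → ℕ → Set
SquareAt p i l = SameOrder l (λ j → p (i + j)) (λ j → p (i + l + j))

-- `i` and `l` are bounded in the shape that `anyUpTo?` returns, so that `hasSquare?` can decide the
-- existence of a square.
HasSquare : List ℕ → Set
HasSquare xs = ∃ λ i → i < suc (length xs) × ∃ λ l → l < suc (length xs) ×
  i + (l + l) ≤ length xs × 2 ≤ l × SquareAt (nth xs) i l

hasSquare : ∀ xs i l → i + (l + l) ≤ length xs → 2 ≤ l → SquareAt (nth xs) i l → HasSquare xs
hasSquare xs i l bound 2≤l s =
  i , s≤s (m+n≤o⇒m≤o i bound) , l , s≤s (m+n≤o⇒m≤o l (m+n≤o⇒n≤o i bound)) , bound , 2≤l , s

containsSquare⇒hasSquare : ∀ {xs} → ContainsSquare xs → HasSquare xs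
containsSquare⇒hasSquare (pre , X , Y , suf , refl , eq , 2≤ , iso) =
  hasSquare xs (length pre) (length X) bound 2≤
    (sameOrder-cong inX inY (orderIso⇒sameOrder X Y iso))
  where
  xs = pre ++ X ++ Y ++ suf
  inX : ∀ {j} → j < length X → nth X j ≡ nth xs (length pre + j)
  inX j<l = sym (trans (nth-++ʳ pre _ _) (nth-++ˡ X _ j<l))
  inY : ∀ {j} → j < length X → nth Y j ≡ nth xs (length pre + length X + j)
  inY {j} j<l = sym (trans (cong (nth xs) (+-assoc (length pre) (length X) j))
    (trans (nth-++ʳ pre _ _) (trans (nth-++ʳ X _ j) (nth-++ˡ Y suf (subst (j <_) eq j<l)))))
  bound : length pre + (length X + length X) ≤ length xs
  bound = begin
    length pre + (length X + length X)        ≡⟨ cong (λ l → length pre + (length X + l)) eq ⟩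
    length pre + (length X + length Y)        ≤⟨ +-monoʳ-≤ (length pre) (+-monoʳ-≤ (length X) (m≤m+n _ (length suf))) ⟩
    length pre + (length X + (length Y + length suf))
      ≡⟨ cong (λ l → length pre + (length X + l)) (length-++ Y) ⟨
    length pre + (length X + length (Y ++ suf)) ≡⟨ cong (length pre +_) (length-++ X) ⟨
    length pre + length (X ++ Y ++ suf)       ≡⟨ length-++ pre ⟨
    length xs                                 ∎
    where open ≤-Reasoning

hasSquare⇒containsSquare : ∀ {xs} → HasSquare xs → ContainsSquare xs
hasSquare⇒containsSquare {xs} (i , _ , l , _ , bound , 2≤l , s) =
  take i xs , X , Y , drop l (drop l (drop i xs)) , split ,
  trans |X| (sym |Y|) , subst (2 ≤_) (sym |X|) 2≤l ,
  sameOrder⇒orderIso X Y (trans |X| (sym |Y|))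
    (subst (λ l → SameOrder l (nth X) (nth Y)) (sym |X|) (sameOrder-cong inX inY s))
  where
  X = take l (drop i xs)
  Y = take l (drop l (drop i xs))
  2l≤ : l + l ≤ length (drop i xs)
  2l≤ = subst (l + l ≤_) (sym (length-drop i xs))
    (subst (_≤ length xs ∸ i) (m+n∸m≡n i (l + l)) (∸-monoˡ-≤ i bound))
  l≤ : l ≤ length (drop l (drop i xs))
  l≤ = subst (l ≤_) (sym (length-drop l (drop i xs)))
    (subst (_≤ length (drop i xs) ∸ l) (m+n∸m≡n l l) (∸-monoˡ-≤ l 2l≤))
  |X| : length X ≡ l
  |X| = trans (length-take l _) (m≤n⇒m⊓n≡m (m+n≤o⇒m≤o l 2l≤))
  |Y| : length Y ≡ l
  |Y| = trans (length-take l _) (m≤n⇒m⊓n≡m l≤)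
  inX : ∀ {j} → j < l → nth xs (i + j) ≡ nth X j
  inX {j} j<l = sym (trans (nth-take l _ j<l) (nth-drop i xs j))
  inY : ∀ {j} → j < l → nth xs (i + l + j) ≡ nth Y j
  inY {j} j<l = sym (trans (nth-take l _ j<l) (trans (nth-drop l (drop i xs) j)
    (trans (nth-drop i xs (l + j)) (cong (nth xs) (sym (+-assoc i l j))))))
  split : xs ≡ take i xs ++ X ++ Y ++ drop l (drop l (drop i xs))
  split = sym (trans
    (cong (λ z → take i xs ++ X ++ z) (take++drop≡id l (drop l (drop i xs))))
    (trans (cong (take i xs ++_) (take++drop≡id l (drop i xs))) (take++drop≡id i xs)))

-- The left end of a square-free sequence.

-- `i ≺ j` stands for a comparison of the entries at positions `i` and `j`. Left abstract, it serves
-- an ascending start as `<` and a descending start as `>`.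
module LeftEnd {n : ℕ} (_≺_ : ℕ → ℕ → Set)
  (≺-irrefl : ∀ {i} → ¬ i ≺ i)
  (≺-trans : ∀ {i j k} → i ≺ j → j ≺ k → i ≺ k)
  (≺-connex : ∀ {i j} → i < n → j < n → i ≢ j → i ≺ j ⊎ j ≺ i)
  (noSquare : ∀ i l → i + (l + l) ≤ n → 2 ≤ l →
    ¬ (∀ {j} → j < l → ∀ {k} → k < l → (i + j) ≺ (i + k) ⇔ (i + l + j) ≺ (i + l + k)))
  where

  ≺-asym : ∀ {i j} → i ≺ j → ¬ j ≺ i
  ≺-asym i≺j j≺i = ≺-irrefl (≺-trans i≺j j≺i)

  Up Down : ℕ → Set
  Up   i = i ≺ suc i
  Down i = suc i ≺ i

  up-or-down : ∀ {i} → suc i < n → Up i ⊎ Down i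
  up-or-down i<n = ≺-connex (<-trans (n<1+n _) i<n) i<n (<⇒≢ (n<1+n _))

  module _ {i} (bound : 4 + i ≤ n) where

    -- For two entries the order type is just rise or fall, so agreement at distance 2 is a square
    -- of half-length 2.
    ¬up-up∨down-down : ¬ ((Up i × Up (2 + i)) ⊎ (Down i × Down (2 + i)))
    ¬up-up∨down-down same = noSquare i 2 (subst (_≤ n) (+-comm 4 i) bound) ≤-refl (iso same)
      where
      e₀ : i ≡ i + 0
      e₀ = sym (+-identityʳ i)
      e₁ : suc i ≡ i + 1
      e₁ = +-comm 1 i
      e₂ : 2 + i ≡ i + 2 + 0
      e₂ = sym (trans (+-identityʳ (i + 2)) (+-comm i 2))
      e₃ : 3 + i ≡ i + 2 + 1
      e₃ = sym (trans (+-assoc i 2 1) (+-comm i 3))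
      iso : (Up i × Up (2 + i)) ⊎ (Down i × Down (2 + i)) →
            ∀ {j} → j < 2 → ∀ {k} → k < 2 → (i + j) ≺ (i + k) ⇔ (i + 2 + j) ≺ (i + 2 + k)
      iso _ {0} _ {0} _ = mk⇔ (⊥-elim ∘ ≺-irrefl) (⊥-elim ∘ ≺-irrefl)
      iso _ {1} _ {1} _ = mk⇔ (⊥-elim ∘ ≺-irrefl) (⊥-elim ∘ ≺-irrefl)
      iso (inj₁ (u , v)) {0} _ {1} _ = mk⇔ (λ _ → subst₂ _≺_ e₂ e₃ v) (λ _ → subst₂ _≺_ e₀ e₁ u)
      iso (inj₁ (u , v)) {1} _ {0} _ =
        mk⇔ (⊥-elim ∘ ≺-asym (subst₂ _≺_ e₀ e₁ u)) (⊥-elim ∘ ≺-asym (subst₂ _≺_ e₂ e₃ v))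
      iso (inj₂ (u , v)) {0} _ {1} _ =
        mk⇔ (⊥-elim ∘ ≺-asym (subst₂ _≺_ e₁ e₀ u)) (⊥-elim ∘ ≺-asym (subst₂ _≺_ e₃ e₂ v))
      iso (inj₂ (u , v)) {1} _ {0} _ = mk⇔ (λ _ → subst₂ _≺_ e₃ e₂ v) (λ _ → subst₂ _≺_ e₁ e₀ u)
      iso _ {suc (suc _)} (s≤s (s≤s ()))
      iso _ {0} _ {suc (suc _)} (s≤s (s≤s ()))
      iso _ {1} _ {suc (suc _)} (s≤s (s≤s ()))

    ¬up-up : Up i → ¬ Up (2 + i)
    ¬up-up u v = ¬up-up∨down-down (inj₁ (u , v))

    up⇒down : Up (2 + i) → Down i
    up⇒down u = [ (λ v → ⊥-elim (¬up-up v u)) , (λ d → d) ]′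
      (up-or-down (m+n≤o⇒n≤o 2 bound))

    down⇒up : Down (2 + i) → Up i
    down⇒up d = [ (λ u → u) , (λ v → ⊥-elim (¬up-up∨down-down (inj₂ (v , d)))) ]′
      (up-or-down (m+n≤o⇒n≤o 2 bound))

  module _ (up₀ : Up 0) (up₁ : Up 1) where

    -- Rises and falls alternate at distance 2, so a start with two rises continues up, up, down,
    -- down with period 4.
    up-up⇒4∣ : ∀ i → 3 + i ≤ n → Up i → Up (suc i) → 4 ∣ i
    up-up⇒4∣ 0 _ _ _ = divides 0 refl
    up-up⇒4∣ 1 b _ u = ⊥-elim (¬up-up b up₀ u)
    up-up⇒4∣ 2 b u _ = ⊥-elim (¬up-up (m+n≤o⇒n≤o 1 b) up₀ u)
    up-up⇒4∣ 3 b u _ = ⊥-elim (¬up-up (m+n≤o⇒n≤o 1 b) up₁ u)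
    up-up⇒4∣ (suc (suc (suc (suc i)))) b u v =
      ∣m∣n⇒∣m+n ∣-refl (up-up⇒4∣ i (m+n≤o⇒n≤o 4 b)
        (down⇒up (m+n≤o⇒n≤o 3 b) (up⇒down (m+n≤o⇒n≤o 1 b) u))
        (down⇒up (m+n≤o⇒n≤o 2 b) (up⇒down b v)))

    -- The square x 0 … m-1 ~ m … 2m created by an element x put in front of the sequence,
    -- where x is next to the element at position c, on its ≺-larger side.
    FrontSquare : ℕ → ℕ → Set
    FrontSquare c m = 1 ≤ m × m + suc m ≤ n ×
      (∀ {j} → j < m → ∀ {k} → k < m → j ≺ k ⇔ (m + suc j) ≺ (m + suc k)) ×
      (∀ {j} → j < m → c ≺ j ⇔ (m + 0) ≺ (m + suc j))

    -- The half-length is `suc m`. For `m ≥ 3` the rises at 0 and 1 are copied to `suc m` and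
    -- `2 + m`, so `4 ∣ suc m`.
    frontSquare-length : n ≤ 30 → ∀ {c m} → ¬ c ≺ 0 → FrontSquare c m → m ≡ 3 ⊎ m ≡ 7 ⊎ m ≡ 11
    -- Half-length 2: the second half is the rise at 1, which would put the new element below
    -- position 0.
    frontSquare-length _ {m = 1} c⊀0 (_ , _ , _ , front) = ⊥-elim (c⊀0 (from (front ≤-refl) up₁))
    -- Half-length 3: the rise at 0 is copied to 3, against the rise at 1.
    frontSquare-length _ {m = 2} _ (_ , b , iso , _) =
      ⊥-elim (¬up-up b up₁ (to (iso (s≤s z≤n) ≤-refl) up₀))
    frontSquare-length n≤30 {m = m@(suc (suc (suc m′)))} _ (_ , b , iso , _)
      with up-up⇒4∣ (suc m) b′ up-l up-l+1
      where
      b′ : 3 + suc m ≤ n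
      b′ = ≤-trans (+-monoˡ-≤ (suc m) (m≤m+n 3 m′)) b
      up-l : Up (suc m)
      up-l = subst₂ _≺_ (+-comm m 1) (+-comm m 2) (to (iso (s≤s z≤n) (s≤s (s≤s z≤n))) up₀)
      up-l+1 : Up (2 + m)
      up-l+1 = subst₂ _≺_ (+-comm m 2) (+-comm m 3)
        (to (iso (s≤s (s≤s z≤n)) (s≤s (s≤s (s≤s z≤n)))) up₁)
    ... | divides 1 eq = inj₁ (suc-injective eq)
    ... | divides 2 eq = inj₂ (inj₁ (suc-injective eq))
    ... | divides 3 eq = inj₂ (inj₂ (suc-injective eq))
    -- Half-length 16 or more takes `m + suc m ≥ 31` old entries.
    ... | divides (suc (suc (suc (suc k)))) eq =
      ⊥-elim (<⇒≱ (s≤s (m≤m+n 15 (k * 4))) (m+n≤o⇒n≤o (k * 4) (+-cancelˡ-≤ 15 _ _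
        (subst (λ m → m + suc m ≤ 30) (suc-injective eq) (≤-trans b n≤30)))))

    -- Both squares have the same second half, which decides the side of `c′` on which the new
    -- element lies. Next to `c` it lies below `c′`, next to `c′` above.
    frontSquare-unique : ∀ {c c′ m} → c ≺ c′ → c′ < m → FrontSquare c m → ¬ FrontSquare c′ m
    frontSquare-unique c≺c′ c′<m (_ , _ , _ , front) (_ , _ , _ , front′) =
      ≺-irrefl (from (front′ c′<m) (to (front c′<m) c≺c′))

    -- The squares of half-lengths 8 and 12 carry positions 0-3 onto 8-11 and onto 12-15.
    ¬frontSquares-7-11 : ∀ {c c′} → FrontSquare c 7 → ¬ FrontSquare c′ 11
    ¬frontSquares-7-11 (_ , _ , iso₇ , _) (_ , b , iso₁₁ , _) =
      noSquare 8 4 (m+n≤o⇒n≤o 7 b) (s≤s (s≤s z≤n)) λ j<4 k<4 →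
        mk⇔ (to (iso₁₁ (4<11 j<4) (4<11 k<4)) ∘ from (iso₇ (4<7 j<4) (4<7 k<4)))
            (to (iso₇ (4<7 j<4) (4<7 k<4)) ∘ from (iso₁₁ (4<11 j<4) (4<11 k<4)))
      where
      4<7 : ∀ {j} → j < 4 → j < 7
      4<7 j<4 = ≤-trans j<4 (m≤m+n 4 3)
      4<11 : ∀ {j} → j < 4 → j < 11
      4<11 j<4 = ≤-trans j<4 (m≤m+n 4 7)

    -- Equal values are excluded by `frontSquare-unique` and the pair 7, 11 by `¬frontSquares-7-11`.
    -- The bound `c′ < 3` keeps `c′` inside the first half for every admissible value.
    frontSquare-dichotomy : n ≤ 30 → ∀ {c c′ m m′} → c ≺ c′ → c′ < 3 → ¬ c ≺ 0 → ¬ c′ ≺ 0 →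
      FrontSquare c m → FrontSquare c′ m′ → (m ≡ 3 × m′ ≢ 3) ⊎ (m ≢ 3 × m′ ≡ 3)
    frontSquare-dichotomy n≤30 c≺c′ c′<3 c⊀0 c′⊀0 f f′
      with frontSquare-length n≤30 c⊀0 f | frontSquare-length n≤30 c′⊀0 f′
    ... | inj₁ refl        | inj₁ refl        = ⊥-elim (frontSquare-unique c≺c′ c′<3 f f′)
    ... | inj₁ refl        | inj₂ (inj₁ refl) = inj₁ (refl , λ ())
    ... | inj₁ refl        | inj₂ (inj₂ refl) = inj₁ (refl , λ ())
    ... | inj₂ (inj₁ refl) | inj₁ refl        = inj₂ ((λ ()) , refl)
    ... | inj₂ (inj₂ refl) | inj₁ refl        = inj₂ ((λ ()) , refl)
    ... | inj₂ (inj₁ refl) | inj₂ (inj₁ refl) =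
      ⊥-elim (frontSquare-unique c≺c′ (≤-trans c′<3 (m≤m+n 3 4)) f f′)
    ... | inj₂ (inj₂ refl) | inj₂ (inj₂ refl) =
      ⊥-elim (frontSquare-unique c≺c′ (≤-trans c′<3 (m≤m+n 3 8)) f f′)
    ... | inj₂ (inj₁ refl) | inj₂ (inj₂ refl) = ⊥-elim (¬frontSquares-7-11 f f′)
    ... | inj₂ (inj₂ refl) | inj₂ (inj₁ refl) = ⊥-elim (¬frontSquares-7-11 f′ f)

    -- Pigeonhole: among three squares, two agree on whether `m ≡ 3`, against the dichotomy.
    ¬leftCrucial : n ≤ 30 → ¬ (∀ c → c < 3 → ∃ (FrontSquare c))
    ¬leftCrucial n≤30 crucial
      with crucial 0 (s≤s z≤n) | crucial 1 (s≤s (s≤s z≤n)) | crucial 2 ≤-refl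
    ... | _ , f₀ | _ , f₁ | _ , f₂
      with frontSquare-dichotomy n≤30 up₀ (s≤s (s≤s z≤n)) ≺-irrefl (≺-asym up₀) f₀ f₁
         | frontSquare-dichotomy n≤30 up₁ ≤-refl (≺-asym up₀) (≺-asym up₀₂) f₁ f₂
         | frontSquare-dichotomy n≤30 up₀₂ ≤-refl ≺-irrefl (≺-asym up₀₂) f₀ f₂
      where up₀₂ = ≺-trans up₀ up₁
    ... | inj₁ (e₀ , _)  | _              | inj₂ (n₀ , _)  = n₀ e₀
    ... | inj₁ (_ , n₁)  | inj₁ (e₁ , _)  | inj₁ _         = n₁ e₁
    ... | inj₁ _         | inj₂ (_ , e₂)  | inj₁ (_ , n₂)  = n₂ e₂
    ... | inj₂ (n₀ , _)  | _              | inj₁ (e₀ , _)  = n₀ e₀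
    ... | inj₂ (_ , e₁)  | inj₂ (n₁ , _)  | inj₂ _         = n₁ e₁
    ... | inj₂ _         | inj₁ (_ , n₂)  | inj₂ (_ , e₂)  = n₂ e₂

-- Relabelling, and squares created by a new first element.

≢⇒<⊎> : ∀ {m n} → m ≢ n → m < n ⊎ n < m
≢⇒<⊎> {m} {n} m≢n with <-cmp m n
... | tri< m<n _ _ = inj₁ m<n
... | tri≈ _ m≡n _ = ⊥-elim (m≢n m≡n)
... | tri> _ _ n<m = inj₂ n<m

-- A named copy of the relabelling local to `extend`; `extend π x 0` reduces to
-- `x ∷ map (shift x) π`.
shift : ℕ → ℕ → ℕ
shift x p = if p <ᵇ x then p else suc p

shift-cases : ∀ x p → (p < x × shift x p ≡ p) ⊎ (x ≤ p × shift x p ≡ suc p)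
shift-cases x p with p <ᵇ x in eq
... | true  = inj₁ (<ᵇ⇒< p x (subst T (sym eq) _) , refl)
... | false = inj₂ (≮⇒≥ (λ p<x → subst T eq (<⇒<ᵇ p<x)) , refl)

shift-< : ∀ x p q → p < q ⇔ shift x p < shift x q
shift-< x p q with shift-cases x p | shift-cases x q
... | inj₁ (p<x , e) | inj₁ (q<x , f) rewrite e | f = mk⇔ (λ r → r) (λ r → r)
... | inj₁ (p<x , e) | inj₂ (x≤q , f) rewrite e | f =
  mk⇔ (λ p<q → m<n⇒m<1+n p<q) (λ _ → <-≤-trans p<x x≤q)
... | inj₂ (x≤p , e) | inj₁ (q<x , f) rewrite e | f =
  mk⇔ (λ p<q → ⊥-elim (<⇒≱ (<-trans p<q q<x) x≤p)) (λ 1+p<q → <-trans (n<1+n p) 1+p<q)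
... | inj₂ (x≤p , e) | inj₂ (x≤q , f) rewrite e | f = mk⇔ s≤s s≤s⁻¹

≤⇔<shift : ∀ x p → x ≤ p ⇔ x < shift x p
≤⇔<shift x p with shift-cases x p
... | inj₁ (p<x , e) rewrite e = mk⇔ (λ x≤p → ⊥-elim (<⇒≱ p<x x≤p)) (λ x<p → <⇒≤ x<p)
... | inj₂ (x≤p , e) rewrite e = mk⇔ s≤s s≤s⁻¹

<⇔shift< : ∀ x p → p < x ⇔ shift x p < x
<⇔shift< x p with shift-cases x p
... | inj₁ (p<x , e) rewrite e = mk⇔ (λ r → r) (λ r → r)
... | inj₂ (x≤p , e) rewrite e = mk⇔ (λ p<x → ⊥-elim (<⇒≱ p<x x≤p)) (<-trans (n<1+n p))

-- A square of half-length `suc m` beginning with the new element, read off the old entries. Of the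
-- two comparisons with `x`, the first serves an ascending start and the second a descending one.
InsertedSquare : List ℕ → ℕ → Set
InsertedSquare π x = ∃ λ m → 1 ≤ m × m + suc m ≤ length π ×
  (∀ {j} → j < m → ∀ {k} → k < m → p j < p k ⇔ p (m + suc j) < p (m + suc k)) ×
  (∀ {j} → j < m → x ≤ p j ⇔ p (m + 0) < p (m + suc j)) ×
  (∀ {j} → j < m → p j < x ⇔ p (m + suc j) < p (m + 0))
  where p = nth π

insertedSquare : ∀ {π} x → SquareFree π → ContainsSquare (extend π x 0) → InsertedSquare π x
insertedSquare {π} x squareFree c = go (containsSquare⇒hasSquare c)
  where
  p = nth π
  q = nth (map (shift x) π)
  |q| : length (map (shift x) π) ≡ length π
  |q| = length-map (shift x) π
  q≡ : ∀ {i} → i < length π → q i ≡ shift x (p i)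
  q≡ = nth-map (shift x) π
  q-< : ∀ {i j} → i < length π → j < length π → p i < p j ⇔ q i < q j
  q-< i<n j<n rewrite q≡ i<n | q≡ j<n = shift-< x _ _
  infixr 5 _∙_
  _∙_ : ∀ {A B C : Set} → A ⇔ B → B ⇔ C → A ⇔ C
  e ∙ f = mk⇔ (to f ∘ to e) (from e ∘ from f)
  inverse : ∀ {A B : Set} → A ⇔ B → B ⇔ A
  inverse e = mk⇔ (from e) (to e)
  go : HasSquare (extend π x 0) → InsertedSquare π x
  -- The square avoids the new element and relabelling keeps the order, so it is already a square in
  -- `π`.
  go (suc i , _ , l , _ , bound , 2≤l , s) = ⊥-elim (squareFree (hasSquare⇒containsSquare
      (hasSquare π i l bound′ 2≤l λ j<l k<l →
        q-< (left j<l) (left k<l) ∙ s j<l k<l ∙ inverse (q-< (right j<l) (right k<l)))))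
    where
    bound′ : i + (l + l) ≤ length π
    bound′ = subst (i + (l + l) ≤_) |q| (s≤s⁻¹ bound)
    right : ∀ {j} → j < l → i + l + j < length π
    right {j} j<l = <-≤-trans (subst (_< i + (l + l)) (sym (+-assoc i l j))
      (+-monoʳ-< i (+-monoʳ-< l j<l))) bound′
    left : ∀ {j} → j < l → i + j < length π
    left {j} j<l = ≤-<-trans (+-monoˡ-≤ j (m≤m+n i l)) (right j<l)
  -- Position `suc j` of the extension is position `j` of `π`, so the second half starts at position
  -- `m` of `π`.
  go (0 , _ , suc m , _ , bound , 2≤l , s) =
    m , s≤s⁻¹ 2≤l , bound′ ,
    (λ j<m k<m → q-< (left j<m) (left k<m) ∙ s (s≤s j<m) (s≤s k<m)
                 ∙ inverse (q-< (right (s≤s j<m)) (right (s≤s k<m)))) ,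
    (λ j<m → subst (λ z → x ≤ _ ⇔ x < z) (sym (q≡ (left j<m))) (≤⇔<shift x _)
             ∙ s (s≤s z≤n) (s≤s j<m) ∙ inverse (q-< (right (s≤s z≤n)) (right (s≤s j<m)))) ,
    (λ j<m → subst (λ z → _ < x ⇔ z < x) (sym (q≡ (left j<m))) (<⇔shift< x _)
             ∙ s (s≤s j<m) (s≤s z≤n) ∙ inverse (q-< (right (s≤s j<m)) (right (s≤s z≤n))))
    where
    bound′ : m + suc m ≤ length π
    bound′ = subst (m + suc m ≤_) |q| (s≤s⁻¹ bound)
    right : ∀ {j} → j < suc m → m + j < length π
    right j<l = <-≤-trans (+-monoʳ-< m j<l) bound′
    left : ∀ {j} → j < m → j < length π
    left j<m = <-≤-trans j<m (m+n≤o⇒m≤o m bound′)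

-- Monotone triples at the two ends.

Monotone : ℕ → ℕ → ℕ → Set
Monotone a b c = (a < b × b < c) ⊎ (c < b × b < a)

monotone⇒¬leftCrucial : ∀ {n a b c xs} → let π = a ∷ b ∷ c ∷ xs in
  n ≤ 30 → IsPerm n π → SquareFree π → Monotone a b c →
  ¬ (∀ x → 1 ≤ x → x ≤ suc n → ContainsSquare (extend π x 0))
monotone⇒¬leftCrucial {n} {a} {b} {c} {xs} n≤30 (refl , range , unique) squareFree mono crucial =
  -- For `x = suc (p i)` the comparison `x ≤ p j` is by definition `p i < p j`.
  [ (λ (a<b , b<c) → Ascending.¬leftCrucial a<b b<c n≤30 λ i i<3 →
      let pᵢ = proj₂ (All-nth range (i<n i<3))
          m , 1≤m , bound , iso , above , _ = insertedSquare (suc (p i)) squareFree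
            (crucial (suc (p i)) (s≤s z≤n) (s≤s pᵢ))
      in m , 1≤m , bound , iso , above)
  -- Here `x = p i`: relabelling lifts the old entry just above `x`, which is the `≺`-larger side
  -- for the reversed order.
  , (λ (c<b , b<a) → Descending.¬leftCrucial b<a c<b n≤30 λ i i<3 →
      let 1≤pᵢ , pᵢ≤n = All-nth range (i<n i<3)
          m , 1≤m , bound , iso , _ , below = insertedSquare (p i) squareFree
            (crucial (p i) 1≤pᵢ (m≤n⇒m≤1+n pᵢ≤n))
      in m , 1≤m , bound , (λ j<m k<m → iso k<m j<m) , below)
  ]′ mono
  where
  π = a ∷ b ∷ c ∷ xs
  p = nth π
  i<n : ∀ {i} → i < 3 → i < length π
  i<n i<3 = ≤-trans i<3 (s≤s (s≤s (s≤s z≤n)))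
  connex : ∀ {i j} → i < n → j < n → i ≢ j → p i < p j ⊎ p j < p i
  connex i<n j<n i≢j = ≢⇒<⊎> (i≢j ∘ nth-injective unique i<n j<n)
  module Ascending = LeftEnd {n} (λ i j → p i < p j) (<-irrefl refl) <-trans connex
    (λ i l bound 2≤l s → squareFree (hasSquare⇒containsSquare (hasSquare π i l bound 2≤l s)))
  module Descending = LeftEnd {n} (λ i j → p j < p i) (<-irrefl refl) (flip <-trans)
    (λ i<n j<n i≢j → connex j<n i<n (i≢j ∘ sym))
    (λ i l bound 2≤l s → squareFree (hasSquare⇒containsSquare
      (hasSquare π i l bound 2≤l (λ j<l k<l → s k<l j<l))))

fourSquare : ∀ {a b c d xs} → (a < b × c < d) ⊎ (b < a × d < c) → ContainsSquare (a ∷ b ∷ c ∷ d ∷ xs)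
fourSquare {a} {b} {c} {d} {xs} same =
  [] , a ∷ b ∷ [] , c ∷ d ∷ [] , xs , refl , refl , ≤-refl , refl , iso same
  where
  iso : (a < b × c < d) ⊎ (b < a × d < c) → ∀ i j →
    lookup (a ∷ b ∷ []) i < lookup (a ∷ b ∷ []) j ⇔
    lookup (c ∷ d ∷ []) (cast refl i) < lookup (c ∷ d ∷ []) (cast refl j)
  iso _                zero       zero       = mk⇔ (⊥-elim ∘ <-irrefl refl) (⊥-elim ∘ <-irrefl refl)
  iso _                (suc zero) (suc zero) = mk⇔ (⊥-elim ∘ <-irrefl refl) (⊥-elim ∘ <-irrefl refl)
  iso (inj₁ (ab , cd)) zero       (suc zero) = mk⇔ (λ _ → cd) (λ _ → ab)
  iso (inj₁ (ab , cd)) (suc zero) zero       = mk⇔ (⊥-elim ∘ <-asym ab) (⊥-elim ∘ <-asym cd)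
  iso (inj₂ (ba , dc)) zero       (suc zero) = mk⇔ (⊥-elim ∘ <-asym ba) (⊥-elim ∘ <-asym dc)
  iso (inj₂ (ba , dc)) (suc zero) zero       = mk⇔ (λ _ → dc) (λ _ → ba)

StartsMonotone : List ℕ → Set
StartsMonotone π = ∃ λ a → ∃ λ b → ∃ λ c → ∃ λ xs → π ≡ a ∷ b ∷ c ∷ xs × Monotone a b c

-- Induction by two entries. With four entries the first and third steps differ, so the middle step
-- agrees with one of them. Beyond that, a monotone triple at the far end persists, and a monotone
-- `c`, `d`, `e` forces both steps of `a`, `b`, `c` to be opposite to its own.
monotoneEnd : ∀ a b c d xs → let π = a ∷ b ∷ c ∷ d ∷ xs in
  2 ∣ length xs → Unique π → SquareFree π → Monotone a b c ⊎ StartsMonotone (reverse π)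
monotoneEnd a b c d [] _ ((a≢b ∷ _) ∷ (b≢c ∷ _) ∷ (c≢d ∷ _) ∷ _) squareFree
  with ≢⇒<⊎> a≢b | ≢⇒<⊎> b≢c | ≢⇒<⊎> c≢d
... | inj₁ ab | inj₁ bc | _       = inj₁ (inj₁ (ab , bc))
... | inj₂ ba | inj₂ cb | _       = inj₁ (inj₂ (cb , ba))
... | inj₁ ab | _       | inj₁ cd = ⊥-elim (squareFree (fourSquare (inj₁ (ab , cd))))
... | inj₂ ba | _       | inj₂ dc = ⊥-elim (squareFree (fourSquare (inj₂ (ba , dc))))
... | inj₁ ab | inj₂ cb | inj₂ dc = inj₂ (d , c , b , a ∷ [] , refl , inj₁ (dc , cb))
... | inj₂ ba | inj₁ bc | inj₁ cd = inj₂ (d , c , b , a ∷ [] , refl , inj₂ (bc , cd))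
monotoneEnd a b c d (e ∷ []) 2∣1 _ _ = ⊥-elim (toWitnessFalse {a? = 2 ∣? 1} _ 2∣1)
monotoneEnd a b c d (e ∷ f ∷ xs) even ((a≢b ∷ _) ∷ (b≢c ∷ _) ∷ unique) squareFree
  with monotoneEnd c d e f xs (∣m+n∣m⇒∣n even ∣-refl) unique
         (squareFree ∘ containsSquare-∷ ∘ containsSquare-∷)
... | inj₂ (u , v , w , ys , eq , mono) = inj₂ (u , v , w , ys ∷ʳ b ∷ʳ a , eq′ , mono)
  where
  eq′ : reverse (a ∷ b ∷ c ∷ d ∷ e ∷ f ∷ xs) ≡ u ∷ v ∷ w ∷ (ys ∷ʳ b ∷ʳ a)
  eq′ = trans (unfold-reverse a (b ∷ c ∷ d ∷ e ∷ f ∷ xs)) (cong (_∷ʳ a)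
    (trans (unfold-reverse b (c ∷ d ∷ e ∷ f ∷ xs)) (cong (_∷ʳ b) eq)))
... | inj₁ mono with ≢⇒<⊎> a≢b | ≢⇒<⊎> b≢c | mono
...   | inj₁ ab | inj₁ bc | _                = inj₁ (inj₁ (ab , bc))
...   | inj₂ ba | inj₂ cb | _                = inj₁ (inj₂ (cb , ba))
...   | inj₁ ab | inj₂ cb | inj₁ (cd , de) = ⊥-elim (squareFree (fourSquare (inj₁ (ab , cd))))
...   | inj₂ ba | inj₁ bc | inj₁ (cd , de) = ⊥-elim (squareFree (containsSquare-∷ (fourSquare (inj₁ (bc , de)))))
...   | inj₁ ab | inj₂ cb | inj₂ (ed , dc) = ⊥-elim (squareFree (containsSquare-∷ (fourSquare (inj₂ (cb , ed)))))
...   | inj₂ ba | inj₁ bc | inj₂ (ed , dc) = ⊥-elim (squareFree (fourSquare (inj₂ (ba , dc))))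

-- Reduction of the right end to the left, and the lower bound.

isPerm-reverse : ∀ {n π} → IsPerm n π → IsPerm n (reverse π)
isPerm-reverse {π = π} (|π| , range , unique) =
  trans (length-reverse π) |π| , All-resp-↭ (↭-sym (↭-reverse π)) range , Unique-reverse unique

extend-right : ∀ {n} π x → length π ≡ n → extend π x n ≡ map (shift x) π ∷ʳ x
extend-right π x refl = cong₂ (λ l r → l ++ x ∷ r) (take-all _ _ |π′|≤) (drop-all _ _ |π′|≤)
  where
  |π′|≤ : length (map (shift x) π) ≤ length π
  |π′|≤ = ≤-reflexive (length-map (shift x) π)

-- Relabelling acts entrywise, so it commutes with reversal.
reverse-extend-right : ∀ {n} π x → length π ≡ n → reverse (extend π x n) ≡ extend (reverse π) x 0
reverse-extend-right {n} π x |π| = begin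
  reverse (extend π x n)           ≡⟨ cong reverse (extend-right π x |π|) ⟩
  reverse (map (shift x) π ∷ʳ x)   ≡⟨ reverse-++ (map (shift x) π) (x ∷ []) ⟩
  x ∷ reverse (map (shift x) π)    ≡⟨ cong (x ∷_) (reverse-map (shift x) π) ⟨
  x ∷ map (shift x) (reverse π)    ∎
  where open ≡-Reasoning

squareFree-short : ∀ {xs} → length xs ≤ 3 → SquareFree xs
squareFree-short |xs|≤3 c with containsSquare⇒hasSquare c
... | i , _ , l , _ , bound , 2≤l , _ =
  <⇒≱ (≤-refl {4}) (≤-trans (+-mono-≤ 2≤l 2≤l) (≤-trans (m+n≤o⇒n≤o i bound) |xs|≤3))

even<32⇒≤30 : ∀ {n} → 2 ∣ n → n < 32 → n ≤ 30
even<32⇒≤30 2∣n n<32 with m≤n⇒m<n∨m≡n (s≤s⁻¹ n<32)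
... | inj₁ n<31 = s≤s⁻¹ n<31
... | inj₂ refl = ⊥-elim (toWitnessFalse {a? = 2 ∣? 31} _ 2∣n)

¬bicrucial-even : ∀ n π → 2 ∣ n → n < 32 → IsPerm n π → ¬ Bicrucial n π
-- Extensions at lengths 0 and 2 have at most three entries, while a square has at least four;
-- lengths 1 and 3 are odd.
¬bicrucial-even n [] _ _ _ (_ , left , _) =
  squareFree-short (s≤s z≤n) (left 1 ≤-refl (s≤s z≤n))
¬bicrucial-even n (a ∷ []) 2∣n _ (refl , _) _ = toWitnessFalse {a? = 2 ∣? 1} _ 2∣n
¬bicrucial-even n (a ∷ b ∷ []) _ _ _ (_ , left , _) =
  squareFree-short (s≤s (s≤s (s≤s z≤n))) (left 1 ≤-refl (s≤s z≤n))
¬bicrucial-even n (a ∷ b ∷ c ∷ []) 2∣n _ (refl , _) _ = toWitnessFalse {a? = 2 ∣? 3} _ 2∣n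
¬bicrucial-even n π@(a ∷ b ∷ c ∷ d ∷ xs) 2∣n n<32 perm@(|π| , _ , unique) (squareFree , left , right)
  with monotoneEnd a b c d xs even unique squareFree
  where
  even : 2 ∣ length xs
  even = ∣m+n∣m⇒∣n {m = 4} (subst (2 ∣_) (sym |π|) 2∣n) (divides 2 refl)
... | inj₁ mono = monotone⇒¬leftCrucial (even<32⇒≤30 2∣n n<32) perm squareFree mono left
... | inj₂ (u , v , w , ys , eq , mono) =
  monotone⇒¬leftCrucial (even<32⇒≤30 2∣n n<32) (subst (IsPerm n) eq (isPerm-reverse perm))
    (subst SquareFree eq squareFreeʳ) mono
    (subst (λ π → ∀ x → 1 ≤ x → x ≤ suc n → ContainsSquare (extend π x 0)) eq leftʳ)
  where
  squareFreeʳ : SquareFree (reverse π)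
  squareFreeʳ = squareFree ∘ subst ContainsSquare (reverse-involutive π) ∘ containsSquare-reverse
  leftʳ : ∀ x → 1 ≤ x → x ≤ suc n → ContainsSquare (extend (reverse π) x 0)
  leftʳ x 1≤x x≤ = subst ContainsSquare (reverse-extend-right π x |π|)
    (containsSquare-reverse (right x 1≤x x≤))

-- A permutation of length 32, checked by decision.

hasSquare? : ∀ xs → Dec (HasSquare xs)
hasSquare? xs = anyUpTo? (λ i → anyUpTo? (λ l →
  i + (l + l) ≤? length xs ×-dec 2 ≤? l ×-dec
  allUpTo? (λ j → allUpTo? (λ k →
    (nth xs (i + j) <? nth xs (i + k)) ⇔-dec (nth xs (i + l + j) <? nth xs (i + l + k))) l) l) _) _
  where
  _⇔-dec_ : ∀ {A B : Set} → Dec A → Dec B → Dec (A ⇔ B)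
  a? ⇔-dec b? = map′ (λ (f , g) → mk⇔ f g) (λ e → to e , from e) ((a? →-dec b?) ×-dec (b? →-dec a?))

π₃₂ : List ℕ
π₃₂ = 27 ∷ 30 ∷ 32 ∷ 19 ∷ 18 ∷ 20 ∷ 29 ∷ 28 ∷ 23 ∷ 25 ∷ 26 ∷ 6 ∷ 2 ∷ 21 ∷ 24 ∷ 22 ∷
      14 ∷ 17 ∷ 31 ∷ 7 ∷ 5 ∷ 8 ∷ 16 ∷ 15 ∷ 10 ∷ 12 ∷ 13 ∷ 3 ∷ 1 ∷ 9 ∷ 11 ∷ 4 ∷ []

π₃₂-isPerm : IsPerm 32 π₃₂
π₃₂-isPerm = refl , toWitness {a? = all? (λ x → 1 ≤? x ×-dec x ≤? 32) π₃₂} _ ,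
  toWitness {a? = unique? π₃₂} _

π₃₂-bicrucial : Bicrucial 32 π₃₂
π₃₂-bicrucial =
  (λ s → toWitnessFalse {a? = hasSquare? π₃₂} _ (containsSquare⇒hasSquare s)) ,
  -- With `x = suc y` the bound `x ≤ 33` is `y < 33`. Half-length 2 serves `x ≤ 27`, half-length 4
  -- serves 28 to 30, half-length 16 serves 31 and 32, and half-length 8 serves 33.
  (λ { (suc y) _ y< → hasSquare⇒containsSquare
       (toWitness {a? = allUpTo? (λ y → hasSquare? (extend π₃₂ (suc y) 0)) 33} _ y<) }) ,
  -- On the right half-length 2 serves `x ≥ 5`, after 9, 11, 4, and half-length 4 serves `x ≤ 4`,
  -- where 12, 13, 3, 1 precedes 9, 11, 4, `x`.
  (λ { (suc y) _ y< → hasSquare⇒containsSquare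
       (toWitness {a? = allUpTo? (λ y → hasSquare? (extend π₃₂ (suc y) 32)) 33} _ y<) })

theorem6 : (∃ λ (π : List ℕ) → IsPerm 32 π × Bicrucial 32 π)
    × (∀ (n : ℕ) (π : List ℕ) → 2 ∣ n → n < 32 → IsPerm n π → ¬ Bicrucial n π)
theorem6 = (π₃₂ , π₃₂-isPerm , π₃₂-bicrucial) , ¬bicrucial-even
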